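{- For any connected graph $H$, there is a connected graph $G$ such that $H$ is an induced subgraph of $G$ and $G$ is not proper conflict-free $(\mathrm{degree}+1)$-choosable.
   Context: All graphs are simple, finite and undirected. $d_G(v)$ denotes the degree of $v$ in $G$. Given a graph $G$ and a mapping $f:V(G)\to\mathbb{N}$, an $f$-list assignment of $G$ is a function $L$ that maps each $v\in V(G)$ to a set $L(v)$ of at least $f(v)$ colors. For an $f$-list assignment $L$, a proper conflict-free $L$-coloring of $G$ is a coloring $\phi$ of $V(G)$ such that (i) $\phi(v)\in L(v)$ for every $v\in V(G)$, (ii) $\phi$ is proper, i.e. adjacent vertices receive distinct colors, and (iii) for every non-isolated vertex $v\in V(G)$ there is a color that appears exactly once in the neighborhood of $v$ (i.e. is assigned to exactly one neighbor of $v$). $G$ is proper conflict-free $f$-choosable if for every $f$-list assignment $L$ of $G$ there exists a proper conflict-free $L$-coloring of $G$. For a non-negative integer $k$, $G$ is proper conflict-free $(\mathrm{degree}+k)$-choosable if $G$ is proper conflict-free $f$-choosable for the mapping $f(v)=d_G(v)+k$ for every $v\in V(G)$. -}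

module Defs where

open import Data.Fin using (Fin)
open import Data.List using (List; allFin; filter; length)
open import Data.Nat using (ℕ; _+_)
open import Data.Product using (Σ; ∃; ∃!; _×_)
open import Function.Definitions using (Injective)
open import Function.Bundles using (_⇔_)
open import Level using (0ℓ)
open import Relation.Binary.Core using (Rel)
open import Relation.Binary.Definitions using (Symmetric; Irreflexive; Decidable)
open import Relation.Binary.Construct.Closure.ReflexiveTransitive using (Star)
open import Relation.Binary.PropositionalEquality using (_≡_; _≢_)
open import Relation.Unary using (Pred; _∈_)

record Graph : Set₁ where
  field
    order  : ℕ
    Adj    : Rel (Fin order) 0ℓ
    adj?   : Decidable Adj
    sym    : Symmetric Adj
    irrefl : Irreflexive _≡_ Adj

  Vertex : Set
  Vertex = Fin order

  neighbours : Vertex → List Vertex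
  neighbours v = filter (adj? v) (allFin order)

  degree : Vertex → ℕ
  degree v = length (neighbours v)

  NonIsolated : Vertex → Set
  NonIsolated v = ∃ λ w → Adj v w

open Graph using (Vertex; Adj; degree; NonIsolated)

-- The null graph is not counted as connected.
Connected : Graph → Set
Connected G = Vertex G × (∀ u v → Star (Adj G) u v)

-- Up to isomorphism: an injection of vertices that preserves and reflects adjacency.
_IsInducedSubgraphOf_ : Graph → Graph → Set
H IsInducedSubgraphOf G =
  Σ (Vertex H → Vertex G) λ ι →
    Injective _≡_ _≡_ ι × (∀ u v → Adj H u v ⇔ Adj G (ι u) (ι v))

Color : Set
Color = ℕ

-- Color sets are arbitrary predicates, possibly infinite; a set has at least
-- k elements when Fin k injects into it.
AtLeast : ℕ → Pred Color 0ℓ → Set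
AtLeast k P = Σ (Fin k → Color) λ e → Injective _≡_ _≡_ e × (∀ i → e i ∈ P)

IsListAssignment : (G : Graph) → (Vertex G → ℕ) → (Vertex G → Pred Color 0ℓ) → Set
IsListAssignment G f L = ∀ v → AtLeast (f v) (L v)

record IsProperConflictFreeColoring
    (G : Graph) (L : Vertex G → Pred Color 0ℓ) (φ : Vertex G → Color) : Set where
  field
    fromLists    : ∀ v → φ v ∈ L v
    proper       : ∀ u v → Adj G u v → φ u ≢ φ v
    conflictFree : ∀ v → NonIsolated G v →
                   ∃ λ c → ∃! _≡_ λ w → Adj G v w × φ w ≡ c

ProperConflictFreeChoosable : (G : Graph) → (Vertex G → ℕ) → Set₁
ProperConflictFreeChoosable G f =
  (L : Vertex G → Pred Color 0ℓ) → IsListAssignment G f L →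
  ∃ λ φ → IsProperConflictFreeColoring G L φ

ProperConflictFreeDegreePlusChoosable : ℕ → Graph → Set₁
ProperConflictFreeDegreePlusChoosable k G =
  ProperConflictFreeChoosable G (λ v → degree G v + k)

{-# OPTIONS --safe #-}

-- Suppose the vertices x, a, y, b of a 4-cycle other than x have degree 2. Conflict-freeness
-- at a and y separates x from y and a from b, so all four colors are distinct. If
-- L(a) = L(y) = L(b) = T with ∣T∣ = 3, then x cannot use T, so L(x) = T ∪ {c} forces the
-- color c on x; here x may have one further neighbor, since ∣L(x)∣ = 4.
-- Join a new hub to one vertex h₀ of H and, for every c ∈ L(h₀), to two 4-cycles forcing c.
-- However h₀ is colored, every color around the hub appears at least twice. Since h₀
-- gains only one neighbor, L(h₀) can be fixed before the 4-cycles are chosen.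
module Submission where

open import Data.Product using (Σ; _×_)
open import Relation.Nullary using (¬_)
open import Defs

open import Data.Bool as Bool using (Bool; true; false; not)
open import Data.Bool.Properties using (not-¬; ¬-not; not-involutive)
open import Data.Empty using (⊥)
open import Data.Fin as Fin using (Fin; zero; suc; toℕ; inject≤)
open import Data.Fin.Properties
  using (+↔⊎; *↔×; 1↔⊤; 2↔Bool; injective⇒≤; pigeonhole; toℕ-inject≤; toℕ-injective; <⇒≢)
open import Data.List using (List; []; _∷_; map; length; lookup; allFin)
open import Data.List.Membership.Propositional using (_∈_)
open import Data.List.Membership.Propositional.Properties
  using (∈-map⁺; ∈-filter⁻; ∈-lookup; ∈-allFin)
open import Data.List.Properties using (length-map; length-tabulate)
open import Data.List.Relation.Unary.All as All using ()
open import Data.List.Relation.Unary.AllPairs using (_∷_)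
open import Data.List.Relation.Unary.Any using (here; there)
open import Data.List.Relation.Unary.Any.Properties using (lookup-index)
open import Data.List.Relation.Unary.Unique.Propositional using (Unique)
open import Data.List.Relation.Unary.Unique.Propositional.Properties using (filter⁺; allFin⁺)
open import Data.Nat using (ℕ; suc; _+_; _*_; _≤_)
open import Data.Nat.Properties
  using (+-cancelˡ-≡; +-monoˡ-≤; +-comm; +-suc; +-identityʳ; n<1+n)
open import Data.Product using (∃; ∃!; _,_; proj₁; proj₂)
open import Data.Product.Function.NonDependent.Propositional using (_×-↔_)
open import Data.Sum using (_⊎_; inj₁; inj₂)
open import Data.Sum.Function.Propositional using (_⊎-↔_)
open import Data.Sum.Properties using (inj₁-injective)
open import Data.Unit using (⊤; tt)
open import Function using (_∘_; id; _↔_; Inverse; Injection; Injective; mk⇔)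
open import Function.Construct.Composition using (_↔-∘_)
open import Function.Construct.Identity using (↔-id)
open import Function.Properties.Inverse using (↔⇒↣; ↔-sym)
open import Level using (0ℓ)
open import Relation.Binary.Core using (Rel)
open import Relation.Binary.Construct.Closure.ReflexiveTransitive
  using (Star; ε; _◅_; _◅◅_; gmap; reverse)
open import Relation.Binary.Definitions using (Symmetric; Irreflexive; Decidable)
open import Relation.Binary.PropositionalEquality
  using (_≡_; _≢_; refl; sym; trans; cong; subst; subst₂)
open import Relation.Nullary using (Dec; yes; no; ¬?; _×-dec_; contradiction)
open import Relation.Unary using (Pred)

open Graph using (order; Adj; adj?; degree; Vertex)

private variable
  A : Set

-- Degree bounds from lists that cover a neighbourhood

lookup-injective : {xs : List A} → Unique xs → Injective _≡_ _≡_ (lookup xs)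
lookup-injective (x∉ ∷ u) {zero}  {zero}  eq = refl
lookup-injective (x∉ ∷ u) {zero}  {suc j} eq = contradiction eq (All.lookup x∉ (∈-lookup j))
lookup-injective (x∉ ∷ u) {suc i} {zero}  eq = contradiction (sym eq) (All.lookup x∉ (∈-lookup i))
lookup-injective (x∉ ∷ u) {suc i} {suc j} eq = cong suc (lookup-injective u eq)

unique-⊆⇒length≤ : {xs ys : List A} → Unique xs → (∀ {x} → x ∈ xs → x ∈ ys) →
                   length xs ≤ length ys
unique-⊆⇒length≤ {xs = xs} {ys} u xs⊆ys = injective⇒≤ λ {i} {j} eq →
  lookup-injective u
    (trans (lookup-index (position i))
      (trans (cong (lookup ys) eq) (sym (lookup-index (position j)))))
  where
  position : ∀ i → lookup xs i ∈ ys
  position i = xs⊆ys (∈-lookup i)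

-- `neighbours` filters a repetition-free enumeration, so it is no longer than any list covering it.
-- Upper bounds suffice, since lists only have to be large enough.
degree≤length : (G : Graph) (v : Vertex G) (ys : List (Vertex G)) →
                (∀ {w} → Adj G v w → w ∈ ys) → degree G v ≤ length ys
degree≤length G v ys cover =
  unique-⊆⇒length≤ (filter⁺ (adj? G v) (allFin⁺ (order G)))
    (λ w∈ → cover (proj₂ (∈-filter⁻ (adj? G v) {xs = allFin (order G)} w∈)))

-- Membership carries the offset in `Fin m`: pigeonhole can be applied to offsets, and the offset of
-- a color of `h₀` names a pair of 4-cycles.
Interval : ℕ → ℕ → Pred Color 0ℓ
Interval a m x = Σ (Fin m) λ i → x ≡ a + toℕ i

interval-atLeast : ∀ a {d m} → d ≤ m → AtLeast d (Interval a m)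
interval-atLeast a d≤m =
  (λ i → a + toℕ i) ,
  (λ eq → toℕ-injective (+-cancelˡ-≡ a _ _ eq)) ,
  (λ i → inject≤ i d≤m , cong (a +_) (sym (toℕ-inject≤ i d≤m)))

-- The only neighbour with color `c` would have to equal its own twin.
twins⇒¬conflictFree : (G : Graph) (φ : Vertex G → Color) (v : Vertex G) →
  (∀ w → Adj G v w → ∃ λ w′ → w ≢ w′ × Adj G v w′ × φ w′ ≡ φ w) →
  ¬ (∃ λ c → ∃! _≡_ λ w → Adj G v w × φ w ≡ c)
twins⇒¬conflictFree G φ v twin (c , w , (vw , φw≡c) , unique) with twin w vw
... | w′ , w≢w′ , vw′ , eq = w≢w′ (unique (vw′ , trans eq φw≡c))

-- The graph containing `H`

module Construction (H : Graph) (h₀ : Vertex H) (connected : ∀ u v → Star (Adj H) u v) where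

  -- The neighbours of an old vertex lie among the `n` old vertices and the hub, so `n + 2` colors
  -- are enough for its list. The same `k` counts the colors to be forced.
  n k : ℕ
  n = order H
  k = suc (suc n)

  Position : Set
  Position = Bool × Bool

  -- The vertex x of a 4-cycle, the one joined to the hub.
  pattern base = false , false

  -- cyc c false and cyc c true are the two 4-cycles that force the color c.
  V : Set
  V = Fin n ⊎ ⊤ ⊎ (Fin k × Bool × Position)

  pattern old u = inj₁ u
  pattern hub = inj₂ (inj₁ tt)
  pattern cyc c t p = inj₂ (inj₂ (c , t , p))

  N : ℕ
  N = n + (1 + k * (2 * (2 * 2)))

  positions : Fin (2 * 2) ↔ Position
  positions = (2↔Bool ×-↔ 2↔Bool) ↔-∘ *↔×

  iso : Fin N ↔ V
  iso = (↔-id _ ⊎-↔ (1↔⊤ ⊎-↔ cycles) ↔-∘ +↔⊎) ↔-∘ +↔⊎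
    where
    cycles : Fin (k * (2 * (2 * 2))) ↔ (Fin k × Bool × Position)
    cycles = (↔-id _ ×-↔ (2↔Bool ×-↔ positions) ↔-∘ *↔×) ↔-∘ *↔×

  dec : Fin N → V
  dec = Inverse.to iso

  enc : V → Fin N
  enc = Inverse.from iso

  dec-enc : ∀ v → dec (enc v) ≡ v
  dec-enc = Inverse.strictlyInverseˡ iso

  enc-dec : ∀ i → enc (dec i) ≡ i
  enc-dec = Inverse.strictlyInverseʳ iso

  enc-injective : Injective _≡_ _≡_ enc
  enc-injective = Injection.injective (↔⇒↣ (↔-sym iso))

  -- Each 4-cycle is presented as the complete bipartite graph K₂,₂: the first bit of a
  -- position is its side.
  E : Rel V 0ℓ
  E (old u)     (old v)                = Adj H u v
  E (old u)     hub                    = u ≡ h₀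
  E hub         (old u)                = u ≡ h₀
  E hub         (cyc _ _ p)            = p ≡ base
  E (cyc _ _ p) hub                    = p ≡ base
  E (cyc c t (s , _)) (cyc c′ t′ (s′ , _)) = c ≡ c′ × t ≡ t′ × s ≢ s′
  E _           _                      = ⊥

  base? : (p : Position) → Dec (p ≡ base)
  base? base        = yes refl
  base? (true , _)  = no λ ()
  base? (false , true) = no λ ()

  E? : Decidable E
  E? (old u)     (old v)     = adj? H u v
  E? (old u)     hub         = u Fin.≟ h₀
  E? (old _)     (cyc _ _ _) = no id
  E? hub         (old u)     = u Fin.≟ h₀
  E? hub         hub         = no id
  E? hub         (cyc _ _ p) = base? p
  E? (cyc _ _ _) (old _)     = no id
  E? (cyc _ _ p) hub         = base? p
  E? (cyc c t (s , _)) (cyc c′ t′ (s′ , _)) =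
    (c Fin.≟ c′) ×-dec ((t Bool.≟ t′) ×-dec ¬? (s Bool.≟ s′))

  E-sym : Symmetric E
  E-sym {old _}     {old _}     uv = Graph.sym H uv
  E-sym {old _}     {hub}       eq = eq
  E-sym {hub}       {old _}     eq = eq
  E-sym {hub}       {cyc _ _ _} eq = eq
  E-sym {cyc _ _ _} {hub}       eq = eq
  E-sym {cyc _ _ _} {cyc _ _ _} (refl , refl , s≢s′) = refl , refl , s≢s′ ∘ sym

  E-irrefl : Irreflexive _≡_ E
  E-irrefl {old _}     refl uu            = Graph.irrefl H refl uu
  E-irrefl {cyc _ _ _} refl (_ , _ , s≢s) = s≢s refl

  G : Graph
  G = record
    { order  = N
    ; Adj    = λ i j → E (dec i) (dec j)
    ; adj?   = λ i j → E? (dec i) (dec j)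
    ; sym    = λ {i} {j} → E-sym {dec i} {dec j}
    ; irrefl = λ {i} {j} i≡j → E-irrefl {dec i} {dec j} (cong dec i≡j)
    }

  E⇒Adj : ∀ v w → E v w → Adj G (enc v) (enc w)
  E⇒Adj v w = subst₂ E (sym (dec-enc v)) (sym (dec-enc w))

  Adj⇒E : ∀ v w → Adj G (enc v) (enc w) → E v w
  Adj⇒E v w = subst₂ E (dec-enc v) (dec-enc w)

  toHub : ∀ v → Star E v hub
  toHub (old u) = gmap inj₁ id (connected u h₀) ◅◅ _◅_ {j = hub} refl ε
  toHub hub = ε
  toHub (cyc c t base) = _◅_ {j = hub} refl ε
  toHub (cyc c t (true , b)) =
    _◅_ {j = cyc c t base} (refl , refl , λ ()) (_◅_ {j = hub} refl ε)
  toHub (cyc c t (false , true)) =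
    _◅_ {j = cyc c t (true , true)} (refl , refl , λ ())
      (_◅_ {j = cyc c t base} (refl , refl , λ ()) (_◅_ {j = hub} refl ε))

  G-connected : Connected G
  G-connected = enc hub , λ i j → subst₂ (Star (Adj G)) (enc-dec i) (enc-dec j)
    (gmap enc (λ {v} {w} → E⇒Adj v w)
      (toHub (dec i) ◅◅ reverse (λ {v} {w} → E-sym {v} {w}) (toHub (dec j))))

  H-induced : H IsInducedSubgraphOf G
  H-induced = enc ∘ inj₁ , inj₁-injective ∘ enc-injective ,
    λ u v → mk⇔ (E⇒Adj (old u) (old v)) (Adj⇒E (old u) (old v))

  degree≤ : ∀ i (ys : List V) → (∀ {w} → E (dec i) w → w ∈ ys) → degree G i ≤ length ys
  degree≤ i ys cover = subst (degree G i ≤_) (length-map enc ys)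
    (degree≤length G i (map enc ys)
      (λ {w} iw → subst (_∈ map enc ys) (enc-dec w) (∈-map⁺ enc (cover iw))))

  -- The list assignment

  -- Here T is the set of `c + 1`, `c + 2`, `c + 3`, and the base also gets `c`. The hub gets all
  -- colors, which is enough for any degree.
  L : V → Pred Color 0ℓ
  L (old _)         = Interval 0 k
  L hub             = λ _ → ⊤
  L (cyc c _ base)  = Interval (toℕ c) 4
  L (cyc c _ _)     = Interval (suc (toℕ c)) 3

  opposite-side : ∀ {s s′} b → s ≢ s′ → (c : Fin k) (t : Bool) (ys : List V) →
    _∈_ {A = V} (cyc c t (s′ , b)) (cyc c t (not s , false) ∷ cyc c t (not s , true) ∷ ys)
  opposite-side {s} b s≢s′ c t ys with refl ← ¬-not (s≢s′ ∘ sym) with b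
  ... | false = here refl
  ... | true  = there (here refl)

  cover-old : ∀ {u} w → E (old u) w → w ∈ hub ∷ map inj₁ (allFin n)
  cover-old (old v) _ = there (∈-map⁺ inj₁ (∈-allFin v))
  cover-old hub     _ = here refl

  cover-base : ∀ {c t} w → E (cyc c t base) w →
               w ∈ cyc c t (true , false) ∷ cyc c t (true , true) ∷ hub ∷ []
  cover-base hub _ = there (there (here refl))
  cover-base (cyc c t (_ , b)) (refl , refl , s≢s′) = opposite-side b s≢s′ c t _

  cover-inner : ∀ {c t s b} → (s , b) ≢ base → ∀ w → E (cyc c t (s , b)) w →
                w ∈ cyc c t (not s , false) ∷ cyc c t (not s , true) ∷ []
  cover-inner p≢base hub eq = contradiction eq p≢base
  cover-inner p≢base (cyc c t (_ , b)) (refl , refl , s≢s′) = opposite-side b s≢s′ c t _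

  -- The degree enters only as a number `d` bounded by every covering list, so each kind of vertex
  -- can supply its own cover.
  large-enough : ∀ v {d} → (∀ ys → (∀ {w} → E v w → w ∈ ys) → d ≤ length ys) →
                 AtLeast (d + 1) (L v)
  large-enough (old u) {d} bound = interval-atLeast 0
    (subst (d + 1 ≤_) size
      (+-monoˡ-≤ 1 (bound (hub ∷ map inj₁ (allFin n)) (λ {w} → cover-old w))))
    where
    size : length (hub ∷ map inj₁ (allFin n)) + 1 ≡ k
    size = trans (+-comm _ 1)
      (cong (2 +_) (trans (length-map inj₁ (allFin n)) (length-tabulate {n = n} id)))
  large-enough hub bound = toℕ , toℕ-injective , λ _ → tt
  large-enough (cyc c t base) bound =
    interval-atLeast (toℕ c) (+-monoˡ-≤ 1 (bound _ (λ {w} → cover-base w)))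
  large-enough (cyc c t (false , true)) bound =
    interval-atLeast (suc (toℕ c)) (+-monoˡ-≤ 1 (bound _ (λ {w} → cover-inner (λ ()) w)))
  large-enough (cyc c t (true , b)) bound =
    interval-atLeast (suc (toℕ c)) (+-monoˡ-≤ 1 (bound _ (λ {w} → cover-inner (λ ()) w)))

  L-isListAssignment : IsListAssignment G (λ v → degree G v + 1) (L ∘ dec)
  L-isListAssignment i = large-enough (dec i) (degree≤ i)

  -- Contradiction from a coloring

  module _ {φ : Vertex G → Color} (col : IsProperConflictFreeColoring G (L ∘ dec) φ) where
    open IsProperConflictFreeColoring col

    ψ : V → Color
    ψ = φ ∘ enc

    ψ-fromLists : ∀ v → L v (ψ v)
    ψ-fromLists v = subst (λ w → L w (ψ v)) (dec-enc v) (fromLists (enc v))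

    ψ-proper : ∀ v w → E v w → ψ v ≢ ψ w
    ψ-proper v w vw = proper (enc v) (enc w) (E⇒Adj v w vw)

    ¬twins : ∀ v w → E v w →
             ¬ (∀ w → E v w → ∃ λ w′ → w ≢ w′ × E v w′ × ψ w′ ≡ ψ w)
    ¬twins v w vw twin =
      twins⇒¬conflictFree G φ (enc v) twin′ (conflictFree (enc v) (enc w , E⇒Adj v w vw))
      where
      twin′ : ∀ j → Adj G (enc v) j → ∃ λ j′ → j ≢ j′ × Adj G (enc v) j′ × φ j′ ≡ φ j
      twin′ j vj with twin (dec j) (subst (λ x → E x (dec j)) (dec-enc v) vj)
      ... | w′ , j≢w′ , vw′ , eq =
        enc w′ ,
        (λ j≡w′ → j≢w′ (trans (cong dec j≡w′) (dec-enc w′))) ,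
        E⇒Adj v w′ vw′ ,
        trans eq (cong φ (enc-dec j))

    -- Each side of a 4-cycle is the whole neighbourhood of an inner vertex on the other side.
    same-side-distinct : ∀ c t s → ψ (cyc c t (s , false)) ≢ ψ (cyc c t (s , true))
    same-side-distinct c t s eq =
      ¬twins v (cyc c t (s , false)) (refl , refl , not-¬ refl ∘ sym) twin
      where
      v : V
      -- The second bit `true` keeps `v` different from the base for either `s`, so the hub is not
      -- among its neighbours.
      v = cyc c t (not s , true)
      twin : ∀ w → E v w → ∃ λ w′ → w ≢ w′ × E v w′ × ψ w′ ≡ ψ w
      twin hub ()
      twin (cyc _ _ (s′ , b)) (refl , refl , s≢s′)
        with refl ← trans (¬-not (s≢s′ ∘ sym)) (not-involutive s) | b
      ... | false = cyc c t (s , true)  , (λ ()) , (refl , refl , s≢s′) , sym eq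
      ... | true  = cyc c t (s , false) , (λ ()) , (refl , refl , s≢s′) , eq

    -- Opposite sides are adjacent; on one side conflict-freeness separates the colors.
    cycle-rainbow : ∀ c t p q → p ≢ q → ψ (cyc c t p) ≢ ψ (cyc c t q)
    cycle-rainbow c t (s , b) (s′ , b′) p≢q with s Bool.≟ s′
    ... | no s≢s′ = ψ-proper (cyc c t (s , b)) (cyc c t (s′ , b′)) (refl , refl , s≢s′)
    ... | yes refl with b | b′
    ...   | false | false = contradiction refl p≢q
    ...   | false | true  = same-side-distinct c t s
    ...   | true  | false = same-side-distinct c t s ∘ sym
    ...   | true  | true  = contradiction refl p≢q

    -- The other three vertices use up the colors c + 1, c + 2, c + 3.
    base-color : ∀ c t → ψ (cyc c t base) ≡ toℕ c
    base-color c t with ψ-fromLists (cyc c t base)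
    ... | zero  , eq = trans eq (+-identityʳ (toℕ c))
    ... | suc i , eq =
      -- A nonzero offset at the base would put all four vertices into the three colors of T.
      let x , y , x<y , same = pigeonhole (n<1+n 3) (proj₁ ∘ color ∘ position)
      in contradiction (color-determined (position x) (position y) same)
           (cycle-rainbow c t (position x) (position y)
             (<⇒≢ x<y ∘ Injection.injective (↔⇒↣ positions)))
      where
      position : Fin 4 → Position
      position = Inverse.to positions

      color : ∀ p → Interval (suc (toℕ c)) 3 (ψ (cyc c t p))
      color base           = i , trans eq (+-suc (toℕ c) (toℕ i))
      color (false , true) = ψ-fromLists (cyc c t (false , true))
      color (true  , b)    = ψ-fromLists (cyc c t (true , b))

      color-determined : ∀ p q → proj₁ (color p) ≡ proj₁ (color q) →
                         ψ (cyc c t p) ≡ ψ (cyc c t q)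
      color-determined p q same =
        trans (proj₂ (color p))
          (trans (cong (λ j → suc (toℕ c) + toℕ j) same) (sym (proj₂ (color q))))

    impossible : ⊥
    impossible = ¬twins hub (old h₀) refl twin
      where
      twin : ∀ w → E hub w → ∃ λ w′ → w ≢ w′ × E hub w′ × ψ w′ ≡ ψ w
      twin (old u) refl with ψ-fromLists (old u)
      -- The list of `h₀` starts at 0 and has length `k`, so its color is some `c` in `Fin k`, which
      -- the bases for `c` repeat.
      ... | c , eq = cyc c false base , (λ ()) , refl , trans (base-color c false) (sym eq)
      twin (cyc c t base) refl =
        -- The second 4-cycle forcing `c` provides the twin.
        cyc c (not t) base ,
        (λ { eq → not-¬ refl (cong copy eq) }) , refl ,
        trans (base-color c (not t)) (sym (base-color c t))
        where
        copy : V → Bool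
        copy (cyc _ t _) = t
        copy _           = false

theorem5 : (H : Graph) → Connected H →
    Σ Graph λ G →
    Connected G × H IsInducedSubgraphOf G × ¬ ProperConflictFreeDegreePlusChoosable 1 G
theorem5 H (h₀ , connected) =
  G , G-connected , H-induced ,
  λ choosable → impossible (proj₂ (choosable (L ∘ dec) L-isListAssignment))
  where open Construction H h₀ connected
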